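{- $\operatorname{Dist}(\mathrm{PX}(3,2))=2$ and $\rho(\mathrm{PX}(3,2))=3$.
   Context: For integers $n\ge 3$ and $1\le k<n$, the Praeger–Xu graph $\mathrm{PX}(n,k)$ is the simple graph with vertex set $\mathbb Z_n\times\mathbb Z_2^k$; a vertex is written $(i,x)$ with $x=x_0x_1\cdots x_{k-1}$ a bitstring of length $k$. Two vertices $(i,x)$ and $(j,y)$ are adjacent if and only if (after possibly swapping the two vertices) $j=i+1$ in $\mathbb Z_n$ and $x=az_1\cdots z_{k-1}$, $y=z_1\cdots z_{k-1}b$ for some bits $a,b,z_1,\dots,z_{k-1}\in\mathbb Z_2$. For a graph $G$, $\operatorname{Dist}(G)$ is the least $d$ such that some $d$-coloring of the vertices is preserved (class-wise) only by the identity automorphism; if $\operatorname{Dist}(G)=2$, $\rho(G)$ is the minimum size of a color class over all 2-colorings preserved only by the identity automorphism. -}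

module Defs where

open import Data.Nat using (ℕ; zero; suc; _<_; _≤_; NonZero)
open import Data.Nat.DivMod using (_%_)
open import Data.Fin using (Fin; toℕ)

open import Data.Bool using (Bool; true; false)
open import Data.Vec using (Vec; []; _∷_; _∷ʳ_)
open import Data.List using (List; []; _∷_; length; filter; map; concatMap; cartesianProduct)
open import Data.Product using (Σ; ∃; ∃-syntax; _×_; _,_)
open import Data.Sum using (_⊎_)
open import Data.Empty using (⊥)
open import Relation.Nullary using (¬_)
open import Relation.Binary.PropositionalEquality using (_≡_)
open import Function using (_⇔_)
open import Function.Definitions using (Bijective)
import Data.Fin.Properties as FinP
import Data.List as L

-- Vertices of PX(n, k) with k = suc m : pairs (i , x), i ∈ ℤ_n, x a bitstring of length k.
PXV : ℕ → ℕ → Set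
PXV n m = Fin n × Vec Bool (suc m)

PXStep : (n m : ℕ) .{{_ : NonZero n}} → PXV n m → PXV n m → Set
PXStep n m (i , x) (j , y) =
  (toℕ j ≡ suc (toℕ i) % n) ×
  (∃[ a ] ∃[ b ] ∃[ z ] (x ≡ a ∷ z) × (y ≡ z ∷ʳ b))

PXAdj : (n m : ℕ) .{{_ : NonZero n}} → PXV n m → PXV n m → Set
PXAdj n m u v = PXStep n m u v ⊎ PXStep n m v u

record Automorphism {V : Set} (Adj : V → V → Set) : Set₁ where
  field
    fun       : V → V
    bijective : Bijective _≡_ _≡_ fun
    preserves : ∀ u v → Adj u v ⇔ Adj (fun u) (fun v)
open Automorphism public

Distinguishing : {V : Set} (Adj : V → V → Set) (d : ℕ) → (V → Fin d) → Set₁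
Distinguishing {V} Adj d c =
  (σ : Automorphism Adj) → (∀ v → c (fun σ v) ≡ c v) → ∀ v → fun σ v ≡ v

HasDistColoring : {V : Set} (Adj : V → V → Set) → ℕ → Set₁
HasDistColoring {V} Adj d = Σ (V → Fin d) (Distinguishing Adj d)

IsDist : {V : Set} (Adj : V → V → Set) → ℕ → Set₁
IsDist Adj d = HasDistColoring Adj d × (∀ d′ → d′ < d → ¬ HasDistColoring Adj d′)

allBits : (k : ℕ) → List (Vec Bool k)
allBits zero = [] ∷ []
allBits (suc k) = L.map (true ∷_) (allBits k) L.++ L.map (false ∷_) (allBits k)

allPXV : (n m : ℕ) → List (PXV n m)
allPXV n m = cartesianProduct (L.allFin n) (allBits (suc m))

classSize : (n m d : ℕ) → (PXV n m → Fin d) → Fin d → ℕ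
classSize n m d c i = length (filter (λ v → c v FinP.≟ i) (allPXV n m))

IsRhoPX : (n m : ℕ) .{{_ : NonZero n}} → ℕ → Set₁
IsRhoPX n m r =
  (Σ (PXV n m → Fin 2) λ c → Distinguishing (PXAdj n m) 2 c × ∃[ i ] classSize n m 2 c i ≡ r)
  × ((c : PXV n m → Fin 2) → Distinguishing (PXAdj n m) 2 c → ∀ i → r ≤ classSize n m 2 c i)

{-# OPTIONS --safe #-}

-- A colour-preserving automorphism σ sends every vertex v to one that colour refinement cannot
-- tell apart from v.  For the colour class {(0,00), (0,11), (1,00)} refinement separates all
-- vertices, so σ is the identity.  Conversely view (i , xy) as the arc from position i to
-- position i + 1 of ℤ₃ carrying the bits x and y at its ends: flipping the bits at one position
-- fixes both vertices of any pair that avoids this position, and a reflection combined with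
-- bit flips swaps any two vertices on different arcs.  So every set of at most two vertices is
-- stabilised by a nontrivial involution.
module Submission where

open import Defs
open import Data.Product using (_×_)
open import Data.Nat using (NonZero)

open import Data.Bool using (Bool; true; false; _xor_; if_then_else_)
import Data.Bool.Properties as Boolₚ
open import Data.Fin using (Fin; zero; suc; toℕ)
open import Data.Fin.Permutation.Components using (transpose)
import Data.Fin.Properties as Finₚ
open import Data.List using (List; []; _∷_; _++_; allFin; cartesianProduct; cartesianProductWith; filter; length; map)
open import Data.List.Membership.Propositional using (_∈_; find)
import Data.List.Membership.DecPropositional as DecMembership
open import Data.List.Membership.Propositional.Properties
  using (∈-allFin; ∈-cartesianProduct⁺; ∈-filter⁺; ∈-filter⁻; ∈-map⁺; ∈-++⁺ˡ; ∈-++⁺ʳ)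
open import Data.List.Relation.Unary.All as All using (All)
open import Data.List.Relation.Unary.Any as Any using (Any; here)
open import Data.Nat using (ℕ; zero; suc; _<_; s≤s; z≤n)
open import Data.Nat.DivMod using (_%_)
open import Data.Nat.GeneralisedArithmetic using (fold)
import Data.Nat.Properties as ℕₚ
open import Data.Product using (∃; ∃-syntax; _,_; proj₂)
open import Data.Product.Relation.Binary.Pointwise.NonDependent using (≡×≡⇒≡; ≡⇒≡×≡)
open import Data.Sum using ([_,_]′; inj₁; inj₂)
open import Data.Vec using (Vec; []; _∷_; _∷ʳ_)
import Data.Vec.Properties as Vecₚ
open import Function using (_∘_; Equivalence; mk⇔)
open import Function.Consequences.Propositional
  using (inverseᵇ⇒bijective; strictlyInverseˡ⇒inverseˡ; strictlyInverseʳ⇒inverseʳ)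
open import Relation.Binary.Definitions using (Decidable; DecidableEquality)
open import Relation.Binary.PropositionalEquality using (_≡_; _≢_; refl; sym; subst; subst₂)
open import Relation.Nullary using (Dec; ¬_; yes; does)
open import Relation.Nullary.Decidable using (map′; _×-dec_; _→-dec_; _⊎-dec_; ¬?)
import Relation.Unary as U

Fin1-≡ : (a b : Fin 1) → a ≡ b
Fin1-≡ zero zero = refl

-- Two colours leave a single alternative to `i`, so membership in that class determines the colour.
Fin2-≡ : ∀ (i a b : Fin 2) → (a ≡ i → b ≡ i) → (b ≡ i → a ≡ i) → a ≡ b
Fin2-≡ i          zero       zero       _ _ = refl
Fin2-≡ i          (suc zero) (suc zero) _ _ = refl
Fin2-≡ zero       zero       (suc zero) f _ = sym (f refl)
Fin2-≡ (suc zero) zero       (suc zero) _ g = g refl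
Fin2-≡ zero       (suc zero) zero       _ g = g refl
Fin2-≡ (suc zero) (suc zero) zero       f _ = sym (f refl)

-- Unlike ≡-dec of Data.Product.Properties, this decides without evaluating any equality proof.
×-≡-dec : {A B : Set} → DecidableEquality A → DecidableEquality B → DecidableEquality (A × B)
×-≡-dec _≟₁_ _≟₂_ (a , b) (a′ , b′) = map′ ≡×≡⇒≡ ≡⇒≡×≡ ((a ≟₁ a′) ×-dec (b ≟₂ b′))

-- Used instead of toWitness because True a? reduces far more slowly than does a?.
does-true : {A : Set} (a? : Dec A) → does a? ≡ true → A
does-true (yes a) _ = a

module FiniteGraph {V : Set} (_≟_ : DecidableEquality V)
                   (vertices : List V) (complete : ∀ v → v ∈ vertices)
                   {Adj : V → V → Set} (Adj? : Decidable Adj) where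

  every? : {P : V → Set} → U.Decidable P → Dec (∀ v → P v)
  every? P? = map′ (λ all v → All.lookup all (complete v)) (λ p → All.tabulate (λ {v} _ → p v))
                   (All.all? P? vertices)

  some? : {P : V → Set} → U.Decidable P → Dec (∃ P)
  some? P? = map′ Any.satisfied (λ (v , p) → Any.map (λ { refl → p }) (complete v))
                  (Any.any? P? vertices)

  -- An involution is its own inverse, so bijectivity and the reverse implication on edges follow
  -- from these two conditions, both decidable by enumeration.
  IsInvolutiveAutomorphism : (V → V) → Set
  IsInvolutiveAutomorphism s = (∀ v → s (s v) ≡ v) × (∀ u v → Adj u v → Adj (s u) (s v))

  isInvolutiveAutomorphism? : U.Decidable IsInvolutiveAutomorphism
  isInvolutiveAutomorphism? s =
    every? (λ v → s (s v) ≟ v) ×-dec every? (λ u → every? λ v → Adj? u v →-dec Adj? (s u) (s v))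

  involution⇒automorphism : ∀ {s} → IsInvolutiveAutomorphism s → Automorphism Adj
  involution⇒automorphism {s} (invol , adj) = record
    { fun       = s
    ; bijective = inverseᵇ⇒bijective
                    (strictlyInverseˡ⇒inverseˡ s invol , strictlyInverseʳ⇒inverseʳ s invol)
    ; preserves = λ u v → mk⇔ (adj u v) (λ e → subst₂ Adj (invol u) (invol v) (adj (s u) (s v) e))
    }

  NontriviallyStabilises : List V → (V → V) → Set
  NontriviallyStabilises ws s = All (λ w → s w ∈ ws) ws × ∃[ v ] s v ≢ v

  nontriviallyStabilises? : ∀ ws → U.Decidable (NontriviallyStabilises ws)
  nontriviallyStabilises? ws s = All.all? (λ w → s w ∈? ws) ws ×-dec some? (λ v → ¬? (s v ≟ v))
    where open DecMembership _≟_ using (_∈?_)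

  -- Since `s` maps class `i` into itself and undoes itself, it also preserves the complement; with
  -- two colours this makes it colour-preserving.
  stabilised-class⇒¬distinguishing : ∀ (c : V → Fin 2) i {s} → IsInvolutiveAutomorphism s →
    NontriviallyStabilises (filter (λ v → c v Finₚ.≟ i) vertices) s → ¬ Distinguishing Adj 2 c
  stabilised-class⇒¬distinguishing c i {s} aut@(invol , _) (stab , v , sv≢v) dist =
    sv≢v (dist (involution⇒automorphism aut) preserved v)
    where
    closed : ∀ w → c w ≡ i → c (s w) ≡ i
    closed w cw≡i = proj₂ (∈-filter⁻ (λ u → c u Finₚ.≟ i) {xs = vertices}
      (All.lookup stab (∈-filter⁺ (λ u → c u Finₚ.≟ i) (complete w) cw≡i)))

    preserved : ∀ w → c (s w) ≡ c w
    preserved w = Fin2-≡ i (c (s w)) (c w)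
      (λ e → subst (λ u → c u ≡ i) (invol w) (closed (s w) e)) (closed w)

  moving-involution⇒¬distinguishing : ∀ (c : V → Fin 1) {s} → IsInvolutiveAutomorphism s →
    ∃[ v ] s v ≢ v → ¬ Distinguishing Adj 1 c
  moving-involution⇒¬distinguishing c {s} aut (v , sv≢v) dist =
    sv≢v (dist (involution⇒automorphism aut) (λ w → Fin1-≡ (c (s w)) (c w)) v)

  module ColourRefinement {d : ℕ} (c : V → Fin d) where

    _∈ₚ?_ : Decidable {A = V × V} _∈_
    _∈ₚ?_ = DecMembership._∈?_ (×-≡-dec _≟_ _≟_)

    -- The back-and-forth condition of a bisimulation: neighbours are compared through `R` without
    -- counting multiplicities.
    Matched : List (V × V) → V × V → Set
    Matched R (u , v) = (∀ w → Adj u w → ∃[ w′ ] Adj v w′ × (w , w′) ∈ R)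
                      × (∀ w′ → Adj v w′ → ∃[ w ] Adj u w × (w , w′) ∈ R)

    matched? : ∀ R → U.Decidable (Matched R)
    matched? R (u , v) =
      every? (λ w → Adj? u w →-dec some? λ w′ → Adj? v w′ ×-dec ((w , w′) ∈ₚ? R)) ×-dec
      every? (λ w′ → Adj? v w′ →-dec some? λ w → Adj? u w ×-dec ((w , w′) ∈ₚ? R))

    sameColour : List (V × V)
    sameColour = filter (λ (u , v) → c v Finₚ.≟ c u) (cartesianProduct vertices vertices)

    refine : List (V × V) → List (V × V)
    refine R = filter (matched? R) R

    indistinguishable : ℕ → List (V × V)
    indistinguishable = fold sameColour refine

    module _ (σ : Automorphism Adj) where

      image-matched : ∀ {R} → (∀ v → (v , fun σ v) ∈ R) → ∀ v → Matched R (v , fun σ v)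
      image-matched {R} inR v = forth , back
        where
        forth : ∀ w → Adj v w → ∃[ w′ ] Adj (fun σ v) w′ × (w , w′) ∈ R
        forth w e = fun σ w , Equivalence.to (preserves σ v w) e , inR w

        back : ∀ w′ → Adj (fun σ v) w′ → ∃[ w ] Adj v w × (w , w′) ∈ R
        -- Surjectivity writes `w′` as `fun σ w`, so that the edge can be pulled back along `σ`.
        back w′ e with w , σ≡ ← proj₂ (bijective σ) w′ with refl ← σ≡ refl =
          w , Equivalence.from (preserves σ v w) e , inR w

      -- Induction on rounds: the graph of `σ` lies in `sameColour` because colours are preserved,
      -- and `image-matched` carries it through each refinement.
      image-indistinguishable : (∀ v → c (fun σ v) ≡ c v) →
                                ∀ k v → (v , fun σ v) ∈ indistinguishable k
      image-indistinguishable pres zero v =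
        ∈-filter⁺ _ (∈-cartesianProduct⁺ (complete v) (complete (fun σ v))) (pres v)
      image-indistinguishable pres (suc k) v =
        ∈-filter⁺ _ (ih v) (image-matched ih v)
        where ih = image-indistinguishable pres k

    discrete? : ∀ k → Dec (All (λ (u , v) → v ≡ u) (indistinguishable k))
    discrete? k = All.all? (λ (u , v) → v ≟ u) (indistinguishable k)

    discrete⇒distinguishing : ∀ k → does (discrete? k) ≡ true → Distinguishing Adj d c
    discrete⇒distinguishing k discrete σ pres v =
      All.lookup (does-true (discrete? k) discrete) (image-indistinguishable σ pres k v)

_≟ᵥ_ : ∀ {n m} → DecidableEquality (PXV n m)
_≟ᵥ_ = ×-≡-dec Finₚ._≟_ (Vecₚ.≡-dec Boolₚ._≟_)

∈-allBits : ∀ {k} (x : Vec Bool k) → x ∈ allBits k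
∈-allBits []          = here refl
∈-allBits (true ∷ x)  = ∈-++⁺ˡ (∈-map⁺ _ (∈-allBits x))
∈-allBits (false ∷ x) = ∈-++⁺ʳ _ (∈-map⁺ _ (∈-allBits x))

∈-allPXV : ∀ {n m} (v : PXV n m) → v ∈ allPXV n m
∈-allPXV (i , x) = ∈-cartesianProduct⁺ (∈-allFin i) (∈-allBits x)

pxStep? : ∀ n m .{{_ : NonZero n}} → Decidable (PXStep n m)
pxStep? n m (i , a ∷ z) (j , y) =
  (toℕ j ℕₚ.≟ suc (toℕ i) % n) ×-dec
  -- The first string already fixes `a` and `z`, so only the two values of the appended bit are
  -- tried.
  map′ [ (λ e → a , true , z , refl , e) , (λ e → a , false , z , refl , e) ]′
       (λ { (_ , true , _ , refl , e) → inj₁ e ; (_ , false , _ , refl , e) → inj₂ e })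
       (Vecₚ.≡-dec Boolₚ._≟_ y (z ∷ʳ true) ⊎-dec Vecₚ.≡-dec Boolₚ._≟_ y (z ∷ʳ false))

pxAdj? : ∀ n m .{{_ : NonZero n}} → Decidable (PXAdj n m)
pxAdj? n m u v = pxStep? n m u v ⊎-dec pxStep? n m v u

open FiniteGraph _≟ᵥ_ (allPXV 3 1) ∈-allPXV (pxAdj? 3 1)

redVertices : List (PXV 3 1)
redVertices = (zero , false ∷ false ∷ [])
            ∷ (zero , true ∷ true ∷ [])
            ∷ (suc zero , false ∷ false ∷ [])
            ∷ []

colouring : PXV 3 1 → Fin 2
colouring v = if does (v ∈? redVertices) then suc zero else zero
  where open DecMembership _≟ᵥ_ using (_∈?_)

open ColourRefinement colouring

colouring-distinguishing : Distinguishing (PXAdj 3 1) 2 colouring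
-- After three rounds only diagonal pairs survive, as evaluation confirms.
colouring-distinguishing = discrete⇒distinguishing 3 refl

next : Fin 3 → Fin 3
next zero             = suc zero
next (suc zero)       = suc (suc zero)
next (suc (suc zero)) = zero

-- Adjacent vertices agree in the bit at their common position, and both copies are changed by the
-- same value of `f`, so adjacency survives.
xorBits : (Fin 3 → Bool) → PXV 3 1 → PXV 3 1
xorBits f (i , x ∷ y ∷ []) = i , (f i xor x) ∷ (f (next i) xor y) ∷ []

isAt : Fin 3 → Fin 3 → Bool
isAt p q = does (p Finₚ.≟ q)

-- The reflection q ↦ 2p − q of ℤ₃ exchanges the arcs starting at p and at p + 2.
reflect : Fin 3 → PXV 3 1 → PXV 3 1
reflect p (i , x ∷ y ∷ []) = transpose p (next (next p)) i , y ∷ x ∷ []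

involutions : List (PXV 3 1 → PXV 3 1)
involutions =
  map (λ p → xorBits (isAt p)) (allFin 3) ++
  cartesianProductWith
    -- The pattern is constant on the two positions that `reflect p` exchanges, so the composite is
    -- an involution. Two distinct arcs meet in one position `p`; two vertices on them are swapped
    -- when `s` is the sum of their bits at `p` and `t` the sum of their other bits.
    (λ { p (s ∷ t ∷ []) → xorBits (λ q → if isAt p q then s else t) ∘ reflect p })
    (allFin 3) (allBits 2)

involutions-automorphisms : All IsInvolutiveAutomorphism involutions
involutions-automorphisms =
  does-true (All.all? isInvolutiveAutomorphism? involutions) refl

-- Splitting on the length leaves finitely many lists, so each case is settled by running through
-- all vertices.
small-set-stabilised : ∀ ws → length ws < 3 → Any (NontriviallyStabilises ws) involutions
small-set-stabilised [] _ =
  does-true (Any.any? (nontriviallyStabilises? []) involutions) refl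
small-set-stabilised (u ∷ []) _ =
  does-true (every? λ u → Any.any? (nontriviallyStabilises? (u ∷ [])) involutions) refl u
small-set-stabilised (u ∷ v ∷ []) _ =
  does-true (every? λ u → every? λ v →
               Any.any? (nontriviallyStabilises? (u ∷ v ∷ [])) involutions) refl u v
small-set-stabilised (_ ∷ _ ∷ _ ∷ _) (s≤s (s≤s (s≤s ())))

small-set-automorphism : ∀ ws → length ws < 3 →
  ∃[ s ] IsInvolutiveAutomorphism s × NontriviallyStabilises ws s
small-set-automorphism ws small =
  let s , s∈ , stab = find (small-set-stabilised ws small)
  in s , All.lookup involutions-automorphisms s∈ , stab

small-class⇒¬distinguishing : ∀ (c : PXV 3 1 → Fin 2) i → classSize 3 1 2 c i < 3 →
                              ¬ Distinguishing (PXAdj 3 1) 2 c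
small-class⇒¬distinguishing c i small =
  let s , aut , stab = small-set-automorphism (filter (λ v → c v Finₚ.≟ i) (allPXV 3 1)) small
  in stabilised-class⇒¬distinguishing c i aut stab

no-smaller-distinguishing : ∀ d → d < 2 → ¬ HasDistColoring (PXAdj 3 1) d
no-smaller-distinguishing zero _ (c , _) with () ← c (zero , false ∷ false ∷ [])
no-smaller-distinguishing (suc zero) _ (c , dist) =
  -- The empty list yields an involution that moves some vertex, and one colour is preserved by
  -- every map.
  let s , aut , _ , moves = small-set-automorphism [] (s≤s z≤n)
  in moving-involution⇒¬distinguishing c aut moves dist
no-smaller-distinguishing (suc (suc _)) (s≤s (s≤s ()))

theorem5p5 : IsDist (PXAdj 3 1) 2 × IsRhoPX 3 1 3
theorem5p5 =
  ((colouring , colouring-distinguishing) , no-smaller-distinguishing) ,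
  -- `suc zero` is the colour of the three red vertices.
  (colouring , colouring-distinguishing , suc zero , refl) ,
  λ c dist i → ℕₚ.≮⇒≥ (λ small → small-class⇒¬distinguishing c i small dist)
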